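{- There exist a constant $c>0$ and, for infinitely many positive integers $n$, a graph $G$ on $n$ vertices with $c_b(G)=1$ and $\mathrm{capt}_b(G)\ge c n^2$; that is, there are graphs with bridge-burning cop number 1 and $\mathrm{capt}_b(G)=\Omega(n^2)$.
   Context: Bridge-burning Cops and Robbers is played on a finite graph $G$ by a team of cops and a single robber, with full information. First each cop chooses a starting vertex (several cops may share a vertex), then the robber chooses a starting vertex. The game then proceeds in rounds; in each round, first every cop either stays put or moves along an edge of the current graph to an adjacent vertex, and then the robber either stays put or moves along an edge of the current graph. Every edge traversed by the robber is immediately deleted from the graph (cop moves delete nothing). The cops win if at some moment some cop occupies the same vertex as the robber; the robber wins if he avoids this forever. $c_b(G)$ is the minimum number of cops for which the cops have a winning strategy. The bridge-burning capture time $\mathrm{capt}_b(G)$ is the minimum number of rounds within which $c_b(G)$ cops can guarantee capturing the robber. -}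

module Defs where

open import Data.Nat using (ℕ; zero; suc; _≤_; _<_)
open import Data.Fin using (Fin; _≟_)
open import Data.Bool using (Bool; true; false; if_then_else_; _∧_; _∨_)
open import Data.Product using (Σ; ∃; _×_; _,_)
open import Data.Sum using (_⊎_)
open import Relation.Nullary using (¬_)
open import Relation.Nullary.Decidable using (⌊_⌋)
open import Relation.Binary.PropositionalEquality using (_≡_)

record Graph (n : ℕ) : Set where
  field
    adj   : Fin n → Fin n → Bool
    sym   : ∀ x y → adj x y ≡ adj y x
    irref : ∀ x → adj x x ≡ false
open Graph public

EdgeSet : ℕ → Set
EdgeSet n = Fin n → Fin n → Bool

delEdge : ∀ {n} → EdgeSet n → Fin n → Fin n → EdgeSet n
delEdge E u v x y =
  if (⌊ x ≟ u ⌋ ∧ ⌊ y ≟ v ⌋) ∨ (⌊ x ≟ v ⌋ ∧ ⌊ y ≟ u ⌋) then false else E x y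

Cops : ℕ → ℕ → Set
Cops n k = Fin k → Fin n

Caught : ∀ {n k} → Cops n k → Fin n → Set
Caught cs r = ∃ λ i → cs i ≡ r

CopMove : ∀ {n k} → EdgeSet n → Cops n k → Cops n k → Set
CopMove E cs cs' = ∀ i → (cs' i ≡ cs i) ⊎ (E (cs i) (cs' i) ≡ true)

-- CopWin t E cs r : with current graph E, cops at cs, robber at r, and the
-- cops about to move, the cops can guarantee capture within t further rounds.
data CopWin {n k : ℕ} : ℕ → EdgeSet n → Cops n k → Fin n → Set where
  caught : ∀ {t E cs r} → Caught cs r → CopWin t E cs r
  step   : ∀ {t E cs r} (cs' : Cops n k) → CopMove E cs cs' →
           (Caught cs' r ⊎
             (CopWin t E cs' r ×
              (∀ r' → E r r' ≡ true → CopWin t (delEdge E r r') cs' r'))) →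
           CopWin (suc t) E cs r

CopsWinIn : ∀ {n} → Graph n → ℕ → ℕ → Set
CopsWinIn {n} G k t = Σ (Cops n k) λ cs → ∀ r → CopWin t (adj G) cs r

CopsWin : ∀ {n} → Graph n → ℕ → Set
CopsWin G k = ∃ λ t → CopsWinIn G k t

CopNumberB : ∀ {n} → Graph n → ℕ → Set
CopNumberB G k = CopsWin G k × (∀ j → j < k → ¬ CopsWin G j)

CaptB : ∀ {n} → Graph n → ℕ → Set
CaptB G T = ∃ λ k → CopNumberB G k × CopsWinIn G k T ×
                    (∀ t → CopsWinIn G k t → T ≤ t)

{-# OPTIONS --safe #-}
-- The graph is the complete bipartite graph K with parts of size 3M.  A single
-- cop wins by shuttling along a fixed edge so as to stand on the side opposite
-- to the robber: the robber can then neither stay put nor step onto that edge, so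
-- he burns another edge in every round.
-- For the lower bound, group each part into M triples.  The robber stays put
-- unless the cop is adjacent, and then moves along a trail of triples
-- that joins any two triples at most once.  Within the next triple he avoids the
-- cop and the vertex he has just come from.  Such a trail of length about M²
-- exists, and n = 6M.
module Submission where

open import Defs
open import Data.Nat using (ℕ; _≤_; _*_; _^_; NonZero)
open import Data.Product using (Σ; ∃; _×_)

open import Data.Bool using (Bool; true; false; not; _xor_)
import Data.Bool.Properties as Bool
open import Data.Fin using (Fin; zero; suc; toℕ; fromℕ<; combine; remQuot; _≟_)
open import Data.Fin.Properties using (any?; all?; remQuot-combine; toℕ-fromℕ<)
open import Data.List using (List; length; filter; allFin; cartesianProduct)
open import Data.List.Membership.Propositional using (_∈_; lose)
open import Data.List.Membership.Propositional.Properties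
  using (∈-filter⁺; ∈-cartesianProduct⁺; ∈-allFin)
open import Data.List.Properties using (filter-notAll)
open import Data.Nat using (zero; suc; _+_; _<_; _<ᵇ_; z≤n; s≤s)
open import Data.Nat.Induction using (<-rec)
open import Data.Nat.Properties
  using (≤-refl; ≤-trans; <-≤-trans; ≤-reflexive; <⇒≤; n<1+n; n≤1+n; m<n⇒m<1+n; m≤n⇒m≤1+n;
         m≤n*m; <-irrefl; ≮⇒≥; anyUpTo?; +-monoʳ-≤; *-monoʳ-≤; module ≤-Reasoning)
open import Data.Nat.Tactic.RingSolver using (solve-∀)
open import Data.Product using (_,_; proj₁; proj₂)
open import Data.Product.Properties using (≡-dec)
open import Data.Sum using (_⊎_; inj₁; inj₂)
open import Function using (_∘_; const)
open import Relation.Binary.PropositionalEquality as ≡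
  using (_≡_; _≢_; refl; cong; subst; trans)
open import Relation.Nullary using (¬_; Dec; yes; no; contradiction)
open import Relation.Nullary.Decidable
  using (map′; toWitness; ¬?; _×-dec_; _⊎-dec_; _→-dec_)
open import Relation.Unary using (Decidable)

private variable
  n : ℕ

-- Edge deletion.

delEdge-⊆ : ∀ (E : EdgeSet n) u v x y → delEdge E u v x y ≡ true → E x y ≡ true
delEdge-⊆ E u v x y e with x ≟ u | y ≟ v | x ≟ v | y ≟ u
... | yes _ | no _  | no _  | _     = e
... | yes _ | no _  | yes _ | no _  = e
... | no _  | _     | no _  | _     = e
... | no _  | _     | yes _ | no _  = e

delEdge-other : ∀ (E : EdgeSet n) u v x y → ¬ (x ≡ u × y ≡ v) → ¬ (x ≡ v × y ≡ u) →
                delEdge E u v x y ≡ E x y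
delEdge-other E u v x y ≢uv ≢vu with x ≟ u | y ≟ v | x ≟ v | y ≟ u
... | yes p | yes q | _     | _     = contradiction (p , q) ≢uv
... | _     | _     | yes p | yes q = contradiction (p , q) ≢vu
... | yes _ | no _  | no _  | _     = refl
... | yes _ | no _  | yes _ | no _  = refl
... | no _  | _     | no _  | _     = refl
... | no _  | _     | yes _ | no _  = refl

delEdge-deleted : ∀ (E : EdgeSet n) u v → delEdge E u v u v ≢ true
delEdge-deleted E u v e with u ≟ u | v ≟ v
delEdge-deleted E u v () | yes _ | yes _
... | no u≢u | _      = u≢u refl
... | yes _  | no v≢v = v≢v refl

-- Deciding the one-cop game.

Move : EdgeSet n → Fin n → Fin n → Set
Move E c c' = c' ≡ c ⊎ E c c' ≡ true

-- Passing from functions on `Fin 1` to constant functions lets the search for a cop move range over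
-- vertices.
copWin-constant : ∀ {t} {E : EdgeSet n} {cs : Cops n 1} {r} →
                  CopWin t E cs r → CopWin {n} {1} t E (const (cs zero)) r
copWin-constant (caught (zero , e)) = caught (zero , e)
copWin-constant (step cs' mv w)     = step cs' (λ { zero → mv zero ; (suc ()) }) w

copWin? : ∀ t (E : EdgeSet n) c r → Dec (CopWin {n} {1} t E (const c) r)
copWin? zero E c r = map′ (λ c≡r → caught (zero , c≡r)) (λ { (caught (_ , c≡r)) → c≡r }) (c ≟ r)
copWin? {n} (suc t) E c r = map′ to from
  ((c ≟ r) ⊎-dec any? (λ c' → ((c' ≟ c) ⊎-dec (E c c' Bool.≟ true)) ×-dec
    ((c' ≟ r) ⊎-dec
      (copWin? t E c' r ×-dec
       all? (λ r' → (E r r' Bool.≟ true) →-dec copWin? t (delEdge E r r') c' r')))))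
  where
  Round : Fin n → Set
  Round c' = c' ≡ r ⊎
    (CopWin {n} {1} t E (const c') r ×
     (∀ r' → E r r' ≡ true → CopWin {n} {1} t (delEdge E r r') (const c') r'))

  to : c ≡ r ⊎ (∃ λ c' → Move E c c' × Round c') → CopWin (suc t) E (const c) r
  to (inj₁ c≡r)                  = caught (zero , c≡r)
  to (inj₂ (c' , mv , inj₁ e))   = step (const c') (const mv) (inj₁ (zero , e))
  to (inj₂ (c' , mv , inj₂ w))   = step (const c') (const mv) (inj₂ w)

  from : CopWin (suc t) E (const c) r → c ≡ r ⊎ (∃ λ c' → Move E c c' × Round c')
  from (caught (_ , c≡r))                    = inj₁ c≡r
  from (step cs' mv (inj₁ (zero , e)))       = inj₂ (cs' zero , mv zero , inj₁ e)
  from (step cs' mv (inj₂ (stay , move)))    =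
    inj₂ (cs' zero , mv zero , inj₂ (copWin-constant stay , λ r' e → copWin-constant (move r' e)))

copsWinIn? : (G : Graph n) → Decidable (CopsWinIn G 1)
copsWinIn? G t = map′
  (λ (c , w) → const c , w)
  (λ (cs , w) → cs zero , λ r → copWin-constant (w r))
  (any? λ c → all? λ r → copWin? t (adj G) c r)

-- Turns some winning bound into the exact capture time that `CaptB` asks for: as long as a smaller
-- witness is found, descend to it.
least : ∀ {P : ℕ → Set} → Decidable P → ∀ m → P m → ∃ λ k → P k × (∀ j → P j → k ≤ j)
least {P} P? = <-rec _ λ m rec pm → search m rec pm (anyUpTo? P? m)
  where
  search : ∀ m → (∀ {k} → k < m → P k → ∃ λ k → P k × (∀ j → P j → k ≤ j)) → P m →
           Dec (∃ λ k → k < m × P k) → ∃ λ k → P k × (∀ j → P j → k ≤ j)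
  search m rec pm (yes (k , k<m , pk)) = rec k<m pk
  search m rec pm (no none)            = m , pm , λ j pj → ≮⇒≥ λ j<m → none (j , j<m , pj)

-- Robber strategies.

noCops : ∀ {t} {E : EdgeSet n} {cs : Cops n 0} {r} → ¬ CopWin t E cs r
noCops (caught (() , _))
noCops (step _ _ (inj₁ (() , _)))
noCops (step _ _ (inj₂ (stay , _))) = noCops stay

-- The cop is about to move and is neither on nor next to `r`, so his next move cannot capture; `ℓ`
-- counts the moves the robber still has in reserve.
Evades : ℕ → EdgeSet n → Fin n → Set
Evades {n} ℓ E r = ∀ {t} (cs : Cops n 1) → cs zero ≢ r → E (cs zero) r ≢ true →
                   CopWin t E cs r → ℓ < t

evades-zero : ∀ {E : EdgeSet n} {r} → Evades 0 E r
evades-zero cs c≢r _ (caught (zero , e)) = contradiction e c≢r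
evades-zero cs _   _ (step _ _ _)        = s≤s z≤n

-- The robber waits until the cop becomes adjacent, and only then spends one move of his reserve on
-- `escape`.
evades-suc : ∀ {ℓ} {E : EdgeSet n} {r} →
  (∀ c → E c r ≡ true → ∃ λ y →
     E r y ≡ true × c ≢ y × delEdge E r y c y ≢ true × Evades ℓ (delEdge E r y) y) →
  Evades (suc ℓ) E r
evades-suc escape cs c≢r _ (caught (zero , e)) = contradiction e c≢r
evades-suc {E = E} {r} escape cs c≢r c≁r (step cs' mv w) = go w
  where
  c'≢r : cs' zero ≢ r
  c'≢r e with mv zero
  ... | inj₁ c'≡c = c≢r (trans (≡.sym c'≡c) e)
  ... | inj₂ c~c' = c≁r (subst (λ z → E (cs zero) z ≡ true) e c~c')

  go : _ → _
  go (inj₁ (zero , e)) = contradiction e c'≢r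
  go (inj₂ (stay , move)) with E (cs' zero) r Bool.≟ true
  -- Waiting burns nothing, so the same position recurs with one round fewer for the cop.
  ... | no  c'≁r = m<n⇒m<1+n (evades-suc escape cs' c'≢r c'≁r stay)
  ... | yes c'~r with y , r~y , c'≢y , c'≁y , ev ← escape (cs' zero) c'~r =
    s≤s (ev cs' c'≢y c'≁y (move y r~y))

-- The game on a complete bipartite graph.

module CompleteBipartite {n} (side : Fin n → Bool) where

  K : Graph n
  K = record
    { adj   = λ x y → side x xor side y
    ; sym   = λ x y → Bool.xor-comm (side x) (side y)
    ; irref = λ x → Bool.xor-same (side x)
    }

  K-edge : ∀ x y → side x ≢ side y → adj K x y ≡ true
  K-edge x y x≢y with side x | side y
  ... | true  | true  = contradiction refl x≢y
  ... | true  | false = refl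
  ... | false | true  = refl
  ... | false | false = contradiction refl x≢y

  Bipartite : EdgeSet n → Set
  Bipartite E = ∀ x y → E x y ≡ true → side x ≢ side y

  K-bipartite : Bipartite (adj K)
  K-bipartite x y e x≡y with side x | side y
  K-bipartite x y () refl | true  | true
  K-bipartite x y () refl | false | false

  delEdge-bipartite : ∀ {E} u v → Bipartite E → Bipartite (delEdge E u v)
  delEdge-bipartite {E} u v bip x y e = bip x y (delEdge-⊆ E u v x y e)

  opposite : ∀ {x y σ} → side x ≡ σ → side x ≢ side y → side y ≡ not σ
  opposite refl x≢y = Bool.¬-not (x≢y ∘ ≡.sym)

  -- Upper bound: the cop shuttles along the edge between two hubs.

  module Shuttle (hub : Bool → Fin n) (side-hub : ∀ σ → side (hub σ) ≡ σ) where

    -- This is invariant: an uncaptured robber neither starts from a hub nor enters one, so no edge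
    -- at a hub is burnt.
    HubsIntact : EdgeSet n → Set
    HubsIntact E = ∀ σ x → side x ≢ σ → E (hub σ) x ≡ true

    delEdge-hubs : ∀ {E u v} → HubsIntact E → (∀ σ → hub σ ≢ u) → (∀ σ → hub σ ≢ v) →
                   HubsIntact (delEdge E u v)
    delEdge-hubs {E} {u} {v} intact ≢u ≢v σ x x≢σ =
      trans (delEdge-other E u v (hub σ) x (≢u σ ∘ proj₁) (≢v σ ∘ proj₁)) (intact σ x x≢σ)

    edge≟ : (p q : Fin n × Fin n) → Dec (p ≡ q)
    edge≟ = ≡-dec _≟_ _≟_

    strike : ∀ {t E r} c → E c r ≡ true → CopWin {n} {1} (suc t) E (const c) r
    strike {r = r} c e = step (const r) (const (inj₂ e)) (inj₁ (zero , refl))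

    -- The cop crosses to the hub opposite the robber, who must then move or be struck. His move
    -- changes sides, which restores the situation, and removes an entry from the list `es` covering
    -- the edges. With no edge left, one crossing and one strike remain, hence `2 + k`.
    shuttle : ∀ k {E} (es : List (Fin n × Fin n)) → length es ≤ k →
              (∀ x y → E x y ≡ true → (x , y) ∈ es) → Bipartite E → HubsIntact E →
              ∀ σ r → side r ≡ σ → CopWin {n} {1} (2 + k) E (const (hub σ)) r
    shuttle k {E} es es≤k E⊆es bip intact σ r r∈σ with hub σ ≟ r
    ... | yes h≡r = caught (zero , h≡r)
    ... | no  h≢r = step (const τ) (const (inj₂ (intact σ τ τ∉σ))) (inj₂ (strike τ τ~r , move))
      where
      τ = hub (not σ)
      τ∉σ : side τ ≢ σ
      τ∉σ e = Bool.not-¬ e (side-hub (not σ))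
      τ~r : E τ r ≡ true
      τ~r = intact (not σ) r (Bool.not-¬ r∈σ)

      hub≢ : ∀ {x ρ} → side x ≡ ρ → hub ρ ≢ x → ∀ π → hub π ≢ x
      hub≢ refl h≢ π refl = h≢ (cong hub (side-hub π))

      move : ∀ r' → E r r' ≡ true → CopWin (suc k) (delEdge E r r') (const τ) r'
      move r' r~r' with τ ≟ r'
      ... | yes e = caught (zero , e)
      ... | no τ≢r' = continue k (<-≤-trans shorter es≤k)
        where
        E' = delEdge E r r'
        other? = λ p → ¬? (edge≟ p (r , r'))
        es' = filter other? es
        shorter : length es' < length es
        shorter = filter-notAll other? es (lose (E⊆es r r' r~r') (λ ≢ → ≢ refl))
        E'⊆es' : ∀ x y → E' x y ≡ true → (x , y) ∈ es'
        E'⊆es' x y e = ∈-filter⁺ other? (E⊆es x y (delEdge-⊆ E r r' x y e))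
          λ { refl → delEdge-deleted E r r' e }
        r'∈ : side r' ≡ not σ
        r'∈ = opposite r∈σ (bip r r' r~r')
        -- Splitting on the bound makes the recursion structural; bound 0 is impossible because the
        -- robber has just used a listed edge.
        continue : ∀ k → length es' < k → CopWin (suc k) E' (const τ) r'
        continue (suc k) (s≤s es'≤k) =
          shuttle k es' es'≤k E'⊆es' (delEdge-bipartite r r' bip)
            (delEdge-hubs {E} intact (hub≢ r∈σ h≢r) (hub≢ r'∈ τ≢r')) (not σ) r' r'∈

    copsWin : CopsWin K 1
    copsWin = _ , const (hub true) , win
      where
      es = cartesianProduct (allFin n) (allFin n)
      intact : HubsIntact (adj K)
      intact σ x x≢σ = K-edge (hub σ) x λ e → x≢σ (trans (≡.sym e) (side-hub σ))
      win : ∀ r → CopWin (2 + length es) (adj K) (const (hub true)) r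
      win r with side r Bool.≟ true
      ... | yes r∈ = shuttle _ es ≤-refl (λ x y _ → ∈-cartesianProduct⁺ (∈-allFin x) (∈-allFin y))
                       K-bipartite intact true r r∈
      ... | no  r∉ = strike (hub true) (intact true r r∉)

  -- Lower bound: the robber's trail through the triples.

  module Trail (label : Fin n → ℕ) (M : ℕ)
    (avoid : ∀ σ {k} → k < M → ∀ u v →
             ∃ λ y → side y ≡ σ × label y ≡ k × y ≢ u × y ≢ v)
    (σ : Bool) where

    -- `F k j` selects the join of triple `k` on side `σ` with triple `j` on the other side. Both
    -- orientations are recorded since an `EdgeSet` carries no symmetry.
    Fresh : (ℕ → ℕ → Set) → EdgeSet n → Set
    Fresh F E = ∀ a b → side a ≡ σ → side b ≡ not σ → F (label a) (label b) →
                E a b ≡ true × E b a ≡ true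

    ≢-sides : ∀ {a b} → side a ≡ σ → side b ≡ not σ → a ≢ b
    ≢-sides a∈ b∈ refl = Bool.not-¬ a∈ b∈

    -- The burnt edge lies in the join of its endpoints' triples, which `F'` has given up. The two
    -- conclusions serve the two directions of travel.
    delEdge-fresh : ∀ {F F' : ℕ → ℕ → Set} {E u v} → side u ≡ σ → side v ≡ not σ →
      (∀ {k j} → F' k j → F k j) → ¬ F' (label u) (label v) →
      Fresh F E → Fresh F' (delEdge E u v) × Fresh F' (delEdge E v u)
    delEdge-fresh {F' = F'} {E} {u} {v} u∈ v∈ F'⊆F ¬F' fresh =
      (λ a b a∈ b∈ f → let eab , eba = fresh a b a∈ b∈ (F'⊆F f) in
        trans (delEdge-other E u v a b (≢uv f) (λ (a≡v , _) → ≢-sides a∈ v∈ a≡v)) eab ,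
        trans (delEdge-other E u v b a (λ (b≡u , _) → ≢-sides u∈ b∈ (≡.sym b≡u))
          (λ (p , q) → ≢uv f (q , p))) eba) ,
      (λ a b a∈ b∈ f → let eab , eba = fresh a b a∈ b∈ (F'⊆F f) in
        trans (delEdge-other E v u a b (λ (a≡v , _) → ≢-sides a∈ v∈ a≡v) (≢uv f)) eab ,
        trans (delEdge-other E v u b a (λ (p , q) → ≢uv f (q , p))
          (λ (b≡u , _) → ≢-sides u∈ b∈ (≡.sym b≡u))) eba)
      where
      ≢uv : ∀ {a b} → F' (label a) (label b) → ¬ (a ≡ u × b ≡ v)
      ≢uv f (refl , refl) = ¬F' f

    -- Two moves, from triple `i` through `j` opposite to `i'`. A cop adjacent to the robber is on
    -- the side the robber moves to, so by bipartiteness he is not adjacent to the new vertex; it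
    -- only has to differ from his.
    detour : ∀ {ℓ i j i' E x} {F F' : ℕ → ℕ → Set} →
      j < M → i' < M → F i j → F i' j →
      (∀ {k m} → F' k m → F k m) → ¬ F' i j → ¬ F' i' j →
      (∀ {E' x'} → Bipartite E' → Fresh F' E' → side x' ≡ σ → label x' ≡ i' → Evades ℓ E' x') →
      Bipartite E → Fresh F E → side x ≡ σ → label x ≡ i → Evades (2 + ℓ) E x
    detour {i' = i'} {E} {x} {F} {F'} j<M i'<M Fij Fi'j F'⊆F ¬F'ij ¬F'i'j continue bip fresh x∈ refl =
      evades-suc out
      where
      out : _
      out c c~x with y , y∈ , refl , y≢c , _ ← avoid (not σ) j<M c c =
        y , proj₁ (fresh x y x∈ y∈ Fij) , y≢c ∘ ≡.sym ,
        (λ e → delEdge-bipartite x y bip c y e (trans c∈ (≡.sym y∈))) ,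
        evades-suc back
        where
        c∈ : side c ≡ not σ
        c∈ = opposite x∈ (bip c x c~x ∘ ≡.sym)
        E₁ = delEdge E x y
        bip₁ : Bipartite E₁
        bip₁ = delEdge-bipartite x y bip
        back : _
        -- Besides the cop's vertex, `x` is avoided: its edge to `y` has just been burnt, and `i'`
        -- may equal `i`.
        back d d~y with x' , x'∈ , refl , x'≢d , x'≢x ← avoid σ i'<M d x =
          x' , trans (delEdge-other E x y y x'
                       (λ (y≡x , _) → ≢-sides x∈ y∈ (≡.sym y≡x)) (x'≢x ∘ proj₂))
                     (proj₂ (fresh x' y x'∈ y∈ Fi'j)) ,
          x'≢d ∘ ≡.sym ,
          (λ e → delEdge-bipartite y x' bip₁ d x' e (trans d∈ (≡.sym x'∈))) ,
          continue (delEdge-bipartite y x' bip₁)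
            (proj₂ (delEdge-fresh {F'} {F'} x'∈ y∈ (λ f → f) ¬F'i'j
              (proj₁ (delEdge-fresh {F} {F'} x∈ y∈ F'⊆F ¬F'ij fresh)))) x'∈ refl
          where
          d∈ : side d ≡ σ
          d∈ = trans (opposite y∈ (bip₁ d y d~y ∘ ≡.sym)) (Bool.not-involutive σ)

    -- The trail visits the triples i of one part in decreasing order.  From i it
    -- goes to s = i−1, …, 0 of the other part, each time returning to i, and then
    -- passes to i−1 through triple i of the other part.  Pending i s holds of the
    -- joins that may still be used when the robber is at i with s returns to come.
    Pending : ℕ → ℕ → ℕ → ℕ → Set
    Pending i s k j = (k < i × j ≤ suc k) ⊎ (k ≡ i × (j < s ⊎ j ≡ i))

    -- The number of robber moves left on the trail: two for each return and two for each passage to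
    -- the next triple.
    turns : ℕ → ℕ → ℕ
    turns i       (suc s) = 2 + turns i s
    turns (suc i) zero    = 2 + turns i i
    turns zero    zero    = 0

    -- A triple `k` below the current one still needs the joins with `j < k` for returns, `j = k`
    -- for leaving and `j = k + 1` for arriving, whence the bound `j ≤ suc k` in `Pending`. Each
    -- detour gives up exactly the joins it uses.
    evades-turns : ∀ i s {E x} → i < M → s ≤ i → Bipartite E → Fresh (Pending i s) E →
                   side x ≡ σ → label x ≡ i → Evades (turns i s) E x
    evades-turns i (suc s) i<M s<i = detour
      {F = Pending i (suc s)} {F' = Pending i s} (≤-trans (s≤s (<⇒≤ s<i)) i<M) i<M
      (inj₂ (refl , inj₁ ≤-refl)) (inj₂ (refl , inj₁ ≤-refl)) shrink used used
      (evades-turns i s i<M (<⇒≤ s<i))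
      where
      shrink : ∀ {k j} → Pending i s k j → Pending i (suc s) k j
      shrink (inj₁ p)                = inj₁ p
      shrink (inj₂ (e , inj₁ j<s))   = inj₂ (e , inj₁ (m<n⇒m<1+n j<s))
      shrink (inj₂ (e , inj₂ j≡i))   = inj₂ (e , inj₂ j≡i)
      used : ¬ Pending i s i s
      used (inj₁ (i<i , _))          = <-irrefl refl i<i
      used (inj₂ (_ , inj₁ s<s))     = <-irrefl refl s<s
      used (inj₂ (_ , inj₂ s≡i))     = <-irrefl s≡i s<i
    evades-turns (suc i) zero i<M _ = detour
      {F = Pending (suc i) 0} {F' = Pending i i} i<M (<⇒≤ i<M)
      (inj₂ (refl , inj₂ refl)) (inj₁ (≤-refl , ≤-refl)) shrink used used'
      (evades-turns i i (<⇒≤ i<M) ≤-refl)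
      where
      shrink : ∀ {k j} → Pending i i k j → Pending (suc i) 0 k j
      shrink (inj₁ (k<i , j≤))         = inj₁ (m<n⇒m<1+n k<i , j≤)
      shrink (inj₂ (refl , inj₁ j<i))  = inj₁ (≤-refl , m≤n⇒m≤1+n (<⇒≤ j<i))
      shrink (inj₂ (refl , inj₂ refl)) = inj₁ (≤-refl , n≤1+n i)
      used : ¬ Pending i i (suc i) (suc i)
      used (inj₁ (i<i , _)) = <-irrefl refl (<⇒≤ i<i)
      used (inj₂ (() , _))
      used' : ¬ Pending i i i (suc i)
      used' (inj₁ (i<i , _))         = <-irrefl refl i<i
      used' (inj₂ (_ , inj₁ i<i))    = <-irrefl refl (<⇒≤ i<i)
    evades-turns zero zero _ _ _ _ _ _ = evades-zero

    turns-≥ : ∀ i s → s * 2 + turns i 0 ≤ turns i s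
    turns-≥ i zero    = ≤-refl
    turns-≥ i (suc s) = s≤s (s≤s (turns-≥ i s))

    -- Starting one triple higher adds `i + 1` returns and one passage, `2 (i + 1) + 2` moves, while
    -- the square grows by `2 (i + 1) + 1`. The outer `suc` matches the strict inequality in
    -- `Evades`.
    square≤turns : ∀ i → suc i ^ 2 ≤ suc (turns i i)
    square≤turns zero    = ≤-refl
    square≤turns (suc i) = begin
      suc (suc i) ^ 2                          ≡⟨ expand (suc i) ⟩
      suc i * 2 + 1 + suc i ^ 2                ≤⟨ +-monoʳ-≤ (suc i * 2 + 1) (square≤turns i) ⟩
      suc i * 2 + 1 + suc (turns i i)          ≡⟨ regroup (suc i * 2) (turns i i) ⟩
      suc i * 2 + (2 + turns i i)              ≤⟨ turns-≥ (suc i) (suc i) ⟩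
      turns (suc i) (suc i)                    ≤⟨ n≤1+n _ ⟩
      suc (turns (suc i) (suc i))              ∎
      where
      open ≤-Reasoning
      -- m * (m * 1) is the unfolding of m ^ 2, which the solver does not accept
      expand : ∀ m → suc m * (suc m * 1) ≡ m * 2 + 1 + m * (m * 1)
      expand = solve-∀
      regroup : ∀ a b → a + 1 + suc b ≡ a + (2 + b)
      regroup = solve-∀

  square≤capture : ∀ (label : Fin n → ℕ) h →
    (∀ σ {k} → k < suc h → ∀ u v → ∃ λ y → side y ≡ σ × label y ≡ k × y ≢ u × y ≢ v) →
    ∀ t → CopsWinIn K 1 t → suc h ^ 2 ≤ t
  square≤capture label h avoid t (cs , win)
    -- The robber starts in the top triple of the cop's own side, hence not adjacent to him.
    with r , r∈ , refl , r≢c , _ ← avoid (side (cs zero)) (n<1+n h) (cs zero) (cs zero) =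
    ≤-trans (square≤turns h)
      (evades-turns h h ≤-refl ≤-refl K-bipartite (fresh {Pending h h}) r∈ refl cs (r≢c ∘ ≡.sym)
        (λ e → K-bipartite (cs zero) r e (≡.sym r∈)) (win r))
    where
    open Trail label (suc h) avoid (side (cs zero))
    fresh : ∀ {F} → Fresh F (adj K)
    fresh a b a∈ b∈ _ = K-edge a b a≢b , K-edge b a (a≢b ∘ ≡.sym)
      where
      a≢b : side a ≢ side b
      a≢b e = Bool.not-¬ (trans (≡.sym e) a∈) b∈

-- A vertex is a pair of c : Fin 6 and a label: c < 3 decides the side.
module Triples (M : ℕ) where

  colour : Fin (6 * M) → Fin 6
  colour x = proj₁ (remQuot {6} M x)

  label : Fin (6 * M) → ℕ
  label x = toℕ (proj₂ (remQuot {6} M x))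

  part : Fin 6 → Bool
  part c = toℕ c <ᵇ 3

  side : Fin (6 * M) → Bool
  side x = part (colour x)

  -- Each side has three colours and `u`, `v` exclude at most two; settled by exhaustive check.
  third : ∀ σ (u v : Fin 6) → ∃ λ c → part c ≡ σ × c ≢ u × c ≢ v
  third true  = toWitness {a? = all? λ u → all? λ v → any? λ c →
    (part c Bool.≟ true) ×-dec (¬? (c ≟ u) ×-dec ¬? (c ≟ v))} _
  third false = toWitness {a? = all? λ u → all? λ v → any? λ c →
    (part c Bool.≟ false) ×-dec (¬? (c ≟ u) ×-dec ¬? (c ≟ v))} _

  avoid : ∀ σ {k} → k < M → ∀ u v → ∃ λ y → side y ≡ σ × label y ≡ k × y ≢ u × y ≢ v
  avoid σ k<M u v with c , c∈ , c≢u , c≢v ← third σ (colour u) (colour v) =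
    y , trans (cong part colour-y) c∈ ,
    trans (cong (toℕ ∘ proj₂) decode) (toℕ-fromℕ< k<M) ,
    (λ { refl → c≢u (≡.sym colour-y) }) , (λ { refl → c≢v (≡.sym colour-y) })
    where
    y = combine c (fromℕ< k<M)
    decode : remQuot {6} M y ≡ (c , fromℕ< k<M)
    decode = remQuot-combine c (fromℕ< k<M)
    colour-y : colour y ≡ c
    colour-y = cong proj₁ decode

theorem5p2 : Σ ℕ λ p → Σ ℕ λ q → NonZero p × NonZero q ×
    (∀ N → ∃ λ n → N ≤ n × Σ (Graph n) λ G →
    CopNumberB G 1 × ∃ λ T → CaptB G T × p * n ^ 2 ≤ q * T)
-- With `M = h + 1`, `n = 6M` and `T ≥ M²` give `n² = 36M² ≤ 36T`.
theorem5p2 = 1 , 36 , _ , _ , λ h →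
  let open Triples (suc h)
      open CompleteBipartite side
      -- The avoided vertices are dummies: any vertex of triple 0 on each side can be the hub.
      pick = λ σ → avoid σ (s≤s z≤n) zero zero
      open Shuttle (proj₁ ∘ pick) (proj₁ ∘ proj₂ ∘ pick)
      bound , winBound = copsWin
      T , winT , minimal = least (copsWinIn? K) bound winBound
      copNumber : CopNumberB K 1
      copNumber = copsWin , λ { zero _ (_ , _ , win) → noCops (win zero) ; (suc _) (s≤s ()) }
  in 6 * suc h , ≤-trans (n≤1+n h) (m≤n*m (suc h) 6) , K , copNumber ,
     T , (1 , copNumber , winT , minimal) ,
     ≤-trans (≤-reflexive (scale (suc h))) (*-monoʳ-≤ 36 (square≤capture label h avoid T winT))
  where
  scale : ∀ m → 1 * (6 * m * (6 * m * 1)) ≡ 36 * (m * (m * 1))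
  scale = solve-∀
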